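{- If $\Gamma\vdash_n t:A$, then $[\![\Gamma]\!]=[\![A]\!]$, where $[\![-]\!]$ is the interpretation of contexts and types of the annotated language in a categorical model.
   Context: Fix a set $\mathbf{Q}$ of qubits and a set $\mathbf{G}$ of gates; each gate $G$ comes with a tuple $(q_1,\dots,q_n)$ of distinct qubits and a duration $d\in\mathbb{R}_{\ge0}$, written $(G,d,q_1,\dots,q_n)\in\mathbf{G}$. **Types and contexts of the annotated language.** Types: $A,B::=1\mid q\mid A\otimes B\mid\Box_dA$ ($q\in\mathbf{Q}$, $d\in\mathbb{R}$). Contexts are lists of graded declarations $x:^dA$, $d\in\mathbb{R}$; $d+\Gamma$ adds $d$ to every grade of $\Gamma$. **Normal constructor terms.** The judgement $\Gamma\vdash_n t:A$ is generated by: - $\vdash_n *:1$ (empty context); - $x:^0q\vdash_n x:q$ for $q\in\mathbf{Q}$; - from $\Gamma\vdash_n s:A$ and $\Delta\vdash_n t:B$ infer $\Gamma,\Delta\vdash_n(s,t):A\otimes B$; - from $\Gamma\vdash_n t:A$ infer $d+\Gamma\vdash_n\mathrm{box}\ d\ t:\Box_dA$. **Categorical model of the annotated language.** This consists of: a symmetric monoidal category $\mathcal{C}^\otimes$ with unit $I$; for every $q\in\mathbf{Q}$ an object $X_q$; a monoidal functor $\mathrm{Shift}(-)$ from the discrete category of real numbers (monoidal under $+$) to the category of symmetric monoidal endofunctors of $\mathcal{C}^\otimes$ (so there are coherent natural isomorphisms $\mathrm{Shift}(0)(X)\simeq X$, $\mathrm{Shift}(d_1+d_2)(X)\simeq\mathrm{Shift}(d_1)(\mathrm{Shift}(d_2)(X))$,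 $\mathrm{Shift}(d)(I)\simeq I$, $\mathrm{Shift}(d)(X\otimes Y)\simeq\mathrm{Shift}(d)(X)\otimes\mathrm{Shift}(d)(Y)$); for every gate $(G,d,q_1,\dots,q_n)$ a morphism $f_G:\mathrm{Shift}(-d)(\bigotimes_iX_{q_i})\to\bigotimes_iX_{q_i}$; for every $x\in\mathbb{R}$ and $q\in\mathbf{Q}$ a morphism $\mathrm{delay}_x:\mathrm{Shift}(-x)(X_q)\to X_q$. **Interpretation.** $[\![1]\!]:=I$, $[\![q]\!]:=X_q$, $[\![A\otimes B]\!]:=[\![A]\!]\otimes[\![B]\!]$, $[\![\Box_dA]\!]:=\mathrm{Shift}(d)[\![A]\!]$; for contexts, $[\![[]]\!]:=I$ and $[\![x:^dA,\Gamma]\!]:=\mathrm{Shift}(d)[\![A]\!]\otimes[\![\Gamma]\!]$. Monoidality of $\mathrm{Shift}(d)$ gives $[\![d+\Gamma]\!]\simeq\mathrm{Shift}(d)[\![\Gamma]\!]$; in the interpretation of judgements such coherence isomorphisms are inserted where appropriate.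
   Formalization: The equality of ⟦Γ⟧ and ⟦A⟧ is stated as an isomorphism generated by the model's coherence isomorphisms (unitors, associators, Shift coherences), since literal equality fails in non-strict models: for x:⁰q ⊢ x:q, ⟦Γ⟧ is Shift(0)(X_q)⊗I, not X_q. -}

module Defs where

open import Level using (Level; _⊔_; 0ℓ) renaming (suc to lsuc)
open import Algebra.Bundles using (Monoid; CommutativeMonoid; AbelianGroup)
import Algebra.Properties.CommutativeSemigroup as CommutativeSemigroupProperties
import Algebra.Properties.Group as GroupProperties
open import Data.List.Base using (List; []; _∷_; _++_; map; foldr)
open import Data.List.Relation.Binary.Pointwise using (Pointwise)
open import Data.List.Relation.Unary.Unique.Propositional using (Unique)
open import Data.Nat.Base as ℕ using (ℕ)
import Data.Nat.Properties as ℕ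
open import Data.Product.Base using (∃-syntax; _,_)
open import Data.Rational.Base as ℚ using (ℚ; 0ℚ; ½)
import Data.Rational.Properties as ℚ
open import Data.Unit.Polymorphic.Base using (⊤; tt)
open import Relation.Binary.Bundles using (Setoid)
open import Relation.Binary.PropositionalEquality.Core as ≡ using (_≡_; refl; cong; subst)
open import Relation.Binary.Structures using (IsEquivalence)
open import Relation.Binary.PropositionalEquality.Properties using (module ≡-Reasoning)
import Relation.Binary.Reasoning.Setoid as SetoidReasoning

-- Real numbers: Cauchy sequences of rationals, with equality "the
-- difference tends to 0".  There being no quotient types, ℝ is a setoid
-- and everything indexed by ℝ below respects _≈ᴿ_.

record ℝ : Set where
  field
    seq    : ℕ → ℚ
    cauchy : ∀ ε → 0ℚ ℚ.< ε →
             ∃[ N ] (∀ m n → N ℕ.≤ m → N ℕ.≤ n → ℚ.∣ seq m ℚ.- seq n ∣ ℚ.< ε)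

open ℝ public

infix 4 _≈ᴿ_ _≤ᴿ_

record _≈ᴿ_ (x y : ℝ) : Set where
  constructor mk≈
  field
    close : ∀ ε → 0ℚ ℚ.< ε →
            ∃[ N ] (∀ n → N ℕ.≤ n → ℚ.∣ seq x n ℚ.- seq y n ∣ ℚ.< ε)

record _≤ᴿ_ (x y : ℝ) : Set where
  constructor mk≤
  field
    below : ∀ ε → 0ℚ ℚ.< ε →
            ∃[ N ] (∀ n → N ℕ.≤ n → seq x n ℚ.< seq y n ℚ.+ ε)

private
  half-pos : ∀ {ε} → 0ℚ ℚ.< ε → 0ℚ ℚ.< ½ ℚ.* ε
  half-pos {ε} 0<ε =
    subst (ℚ._< ½ ℚ.* ε) (ℚ.*-zeroʳ ½) (ℚ.*-monoʳ-<-pos ½ 0<ε)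

  half+half : ∀ ε → ½ ℚ.* ε ℚ.+ ½ ℚ.* ε ≡ ε
  half+half ε =
    ≡.trans (≡.sym (ℚ.*-distribʳ-+ ε ½ ½)) (ℚ.*-identityˡ ε)

  add-halves : ∀ {ε} p q {r} → r ≡ p ℚ.+ q →
               ℚ.∣ p ∣ ℚ.< ½ ℚ.* ε → ℚ.∣ q ∣ ℚ.< ½ ℚ.* ε → ℚ.∣ r ∣ ℚ.< ε
  add-halves {ε} p q refl hp hq =
    subst (ℚ.∣ p ℚ.+ q ∣ ℚ.<_) (half+half ε)
      (ℚ.≤-<-trans (ℚ.∣p+q∣≤∣p∣+∣q∣ p q) (ℚ.+-mono-< hp hq))

  ∣p-p∣<ε : ∀ {ε} p {q} → p ≡ q → 0ℚ ℚ.< ε → ℚ.∣ p ℚ.- q ∣ ℚ.< ε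
  ∣p-p∣<ε {ε} p refl 0<ε =
    subst (λ z → ℚ.∣ z ∣ ℚ.< ε) (≡.sym (ℚ.+-inverseʳ p)) 0<ε

  interchange : ∀ a b c d →
                (a ℚ.+ b) ℚ.- (c ℚ.+ d) ≡ (a ℚ.- c) ℚ.+ (b ℚ.- d)
  interchange a b c d = ≡.trans
    (cong (a ℚ.+ b ℚ.+_) (ℚ.neg-distrib-+ c d))
    (medial a b (ℚ.- c) (ℚ.- d))
    where open CommutativeSemigroupProperties
                 (CommutativeMonoid.commutativeSemigroup ℚ.+-0-commutativeMonoid)
               using () renaming (interchange to medial)

  telescope : ∀ a b c → a ℚ.- c ≡ (a ℚ.- b) ℚ.+ (b ℚ.- c)
  telescope a b c = ≡.sym (begin
    (a ℚ.- b) ℚ.+ (b ℚ.- c)         ≡⟨ ℚ.+-assoc a (ℚ.- b) (b ℚ.- c) ⟩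
    a ℚ.+ (ℚ.- b ℚ.+ (b ℚ.- c))     ≡⟨ cong (a ℚ.+_) (ℚ.+-assoc (ℚ.- b) b (ℚ.- c)) ⟨
    a ℚ.+ ((ℚ.- b ℚ.+ b) ℚ.- c)     ≡⟨ cong (λ z → a ℚ.+ (z ℚ.- c)) (ℚ.+-inverseˡ b) ⟩
    a ℚ.+ (0ℚ ℚ.- c)                ≡⟨ cong (a ℚ.+_) (ℚ.+-identityˡ (ℚ.- c)) ⟩
    a ℚ.- c                         ∎)
    where open ≡-Reasoning

  ∣-p--q∣≡∣p-q∣ : ∀ p q → ℚ.∣ ℚ.- p ℚ.- ℚ.- q ∣ ≡ ℚ.∣ p ℚ.- q ∣
  ∣-p--q∣≡∣p-q∣ p q = ≡.trans
    (cong ℚ.∣_∣ (≡.sym (ℚ.neg-distrib-+ p (ℚ.- q))))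
    (ℚ.∣-p∣≡∣p∣ (p ℚ.- q))

  ∣q-p∣≡∣p-q∣ : ∀ p q → ℚ.∣ q ℚ.- p ∣ ≡ ℚ.∣ p ℚ.- q ∣
  ∣q-p∣≡∣p-q∣ p q = ≡.trans
    (cong ℚ.∣_∣ (≡.sym (begin
      ℚ.- (p ℚ.- q)       ≡⟨ ℚ.neg-distrib-+ p (ℚ.- q) ⟩
      ℚ.- p ℚ.- ℚ.- q     ≡⟨ cong (ℚ.- p ℚ.+_) (⁻¹-involutive q) ⟩
      ℚ.- p ℚ.+ q         ≡⟨ ℚ.+-comm (ℚ.- p) q ⟩
      q ℚ.- p             ∎)))
    (ℚ.∣-p∣≡∣p∣ (p ℚ.- q))
    where open ≡-Reasoning
          open GroupProperties ℚ.+-0-group using (⁻¹-involutive)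

infixl 6 _+ᴿ_
infix  8 -ᴿ_

0ᴿ : ℝ
0ᴿ .seq _ = 0ℚ
0ᴿ .cauchy ε 0<ε = 0 , λ _ _ _ _ → ∣p-p∣<ε 0ℚ refl 0<ε

_+ᴿ_ : ℝ → ℝ → ℝ
(x +ᴿ y) .seq n = seq x n ℚ.+ seq y n
(x +ᴿ y) .cauchy ε 0<ε
  with M , hx ← cauchy x (½ ℚ.* ε) (half-pos 0<ε)
     | N , hy ← cauchy y (½ ℚ.* ε) (half-pos 0<ε)
  = M ℕ.⊔ N , λ m n N≤m N≤n →
      add-halves (seq x m ℚ.- seq x n) (seq y m ℚ.- seq y n)
        (interchange (seq x m) (seq y m) (seq x n) (seq y n))
        (hx m n (ℕ.m⊔n≤o⇒m≤o M N N≤m) (ℕ.m⊔n≤o⇒m≤o M N N≤n))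
        (hy m n (ℕ.m⊔n≤o⇒n≤o M N N≤m) (ℕ.m⊔n≤o⇒n≤o M N N≤n))

-ᴿ_ : ℝ → ℝ
(-ᴿ x) .seq n = ℚ.- seq x n
(-ᴿ x) .cauchy ε 0<ε with N , h ← cauchy x ε 0<ε
  = N , λ m n N≤m N≤n →
      subst (ℚ._< ε) (≡.sym (∣-p--q∣≡∣p-q∣ (seq x m) (seq x n))) (h m n N≤m N≤n)

private
  pointwise : ∀ {x y} → (∀ n → seq x n ≡ seq y n) → x ≈ᴿ y
  pointwise {x} eq = mk≈ λ ε 0<ε → 0 , λ n _ → ∣p-p∣<ε (seq x n) (eq n) 0<ε

≈ᴿ-isEquivalence : IsEquivalence _≈ᴿ_
≈ᴿ-isEquivalence = record
  { refl  = pointwise λ _ → refl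
  ; sym   = λ {x} {y} (mk≈ h) → mk≈ λ ε 0<ε → let N , k = h ε 0<ε in
      N , λ n N≤n → subst (ℚ._< ε) (≡.sym (∣q-p∣≡∣p-q∣ (seq x n) (seq y n))) (k n N≤n)
  ; trans = λ {x} {y} {z} (mk≈ h) (mk≈ k) → mk≈ λ ε 0<ε →
      let M , h′ = h (½ ℚ.* ε) (half-pos 0<ε)
          N , k′ = k (½ ℚ.* ε) (half-pos 0<ε)
      in M ℕ.⊔ N , λ n N≤n →
        add-halves (seq x n ℚ.- seq y n) (seq y n ℚ.- seq z n)
          (telescope (seq x n) (seq y n) (seq z n))
          (h′ n (ℕ.m⊔n≤o⇒m≤o M N N≤n)) (k′ n (ℕ.m⊔n≤o⇒n≤o M N N≤n))
  }

+ᴿ-cong : ∀ {x x′ y y′} → x ≈ᴿ x′ → y ≈ᴿ y′ → x +ᴿ y ≈ᴿ x′ +ᴿ y′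
+ᴿ-cong {x} {x′} {y} {y′} (mk≈ h) (mk≈ k) = mk≈ λ ε 0<ε →
  let M , h′ = h (½ ℚ.* ε) (half-pos 0<ε)
      N , k′ = k (½ ℚ.* ε) (half-pos 0<ε)
  in M ℕ.⊔ N , λ n N≤n →
    add-halves (seq x n ℚ.- seq x′ n) (seq y n ℚ.- seq y′ n)
      (interchange (seq x n) (seq y n) (seq x′ n) (seq y′ n))
      (h′ n (ℕ.m⊔n≤o⇒m≤o M N N≤n)) (k′ n (ℕ.m⊔n≤o⇒n≤o M N N≤n))

-ᴿ-cong : ∀ {x y} → x ≈ᴿ y → -ᴿ x ≈ᴿ -ᴿ y
-ᴿ-cong {x} {y} (mk≈ h) = mk≈ λ ε 0<ε → let N , k = h ε 0<ε in
  N , λ n N≤n → subst (ℚ._< ε) (≡.sym (∣-p--q∣≡∣p-q∣ (seq x n) (seq y n))) (k n N≤n)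

ℝ-abelianGroup : AbelianGroup 0ℓ 0ℓ
ℝ-abelianGroup = record
  { Carrier = ℝ
  ; _≈_     = _≈ᴿ_
  ; _∙_     = _+ᴿ_
  ; ε       = 0ᴿ
  ; _⁻¹     = -ᴿ_
  ; isAbelianGroup = record
    { isGroup = record
      { isMonoid = record
        { isSemigroup = record
          { isMagma = record
            { isEquivalence = ≈ᴿ-isEquivalence
            ; ∙-cong        = +ᴿ-cong
            }
          ; assoc = λ x y z → pointwise λ n → ℚ.+-assoc (seq x n) (seq y n) (seq z n)
          }
        ; identity = (λ x → pointwise λ n → ℚ.+-identityˡ (seq x n))
                   , (λ x → pointwise λ n → ℚ.+-identityʳ (seq x n))
        }
      ; inverse = (λ x → pointwise λ n → ℚ.+-inverseˡ (seq x n))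
                , (λ x → pointwise λ n → ℚ.+-inverseʳ (seq x n))
      ; ⁻¹-cong = -ᴿ-cong
      }
    ; comm = λ x y → pointwise λ n → ℚ.+-comm (seq x n) (seq y n)
    }
  }

private variable
  o ℓ e o′ ℓ′ e′ : Level

record Category (o ℓ e : Level) : Set (lsuc (o ⊔ ℓ ⊔ e)) where
  infix  4 _≈_ _⇒_
  infixr 9 _∘_
  field
    Obj : Set o
    _⇒_ : Obj → Obj → Set ℓ
    _≈_ : ∀ {A B} → A ⇒ B → A ⇒ B → Set e
    id  : ∀ {A} → A ⇒ A
    _∘_ : ∀ {A B C} → B ⇒ C → A ⇒ B → A ⇒ C

    assoc     : ∀ {A B C D} {f : A ⇒ B} {g : B ⇒ C} {h : C ⇒ D} →
                (h ∘ g) ∘ f ≈ h ∘ (g ∘ f)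
    identityˡ : ∀ {A B} {f : A ⇒ B} → id ∘ f ≈ f
    identityʳ : ∀ {A B} {f : A ⇒ B} → f ∘ id ≈ f
    equiv     : ∀ {A B} → IsEquivalence (_≈_ {A} {B})
    ∘-resp-≈  : ∀ {A B C} {f h : B ⇒ C} {g i : A ⇒ B} →
                f ≈ h → g ≈ i → f ∘ g ≈ h ∘ i

  module Equiv {A B} = IsEquivalence (equiv {A} {B})

  hom-setoid : Obj → Obj → Setoid ℓ e
  hom-setoid A B = record { Carrier = A ⇒ B ; _≈_ = _≈_ ; isEquivalence = equiv }

  module HomReasoning {A B : Obj} = SetoidReasoning (hom-setoid A B)

  ∘-resp-≈ˡ : ∀ {A B C} {f h : B ⇒ C} {g : A ⇒ B} → f ≈ h → f ∘ g ≈ h ∘ g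
  ∘-resp-≈ˡ p = ∘-resp-≈ p Equiv.refl

  ∘-resp-≈ʳ : ∀ {A B C} {f : B ⇒ C} {g i : A ⇒ B} → g ≈ i → f ∘ g ≈ f ∘ i
  ∘-resp-≈ʳ p = ∘-resp-≈ Equiv.refl p

  infix 4 _≅_
  record _≅_ (A B : Obj) : Set (ℓ ⊔ e) where
    field
      from : A ⇒ B
      to   : B ⇒ A
      isoˡ : to ∘ from ≈ id
      isoʳ : from ∘ to ≈ id

  ≅-refl : ∀ {A} → A ≅ A
  ≅-refl = record { from = id ; to = id ; isoˡ = identityˡ ; isoʳ = identityˡ }

  ≅-sym : ∀ {A B} → A ≅ B → B ≅ A
  ≅-sym i = record { from = to ; to = from ; isoˡ = isoʳ ; isoʳ = isoˡ }
    where open _≅_ i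

  private
    cancel-inner : ∀ {A B C D} {f : C ⇒ D} {g : B ⇒ C} {h : C ⇒ B} {k : A ⇒ C} →
                   g ∘ h ≈ id → (f ∘ g) ∘ (h ∘ k) ≈ f ∘ k
    cancel-inner {f = f} {g} {h} {k} p = begin
      (f ∘ g) ∘ (h ∘ k) ≈⟨ assoc ⟩
      f ∘ (g ∘ (h ∘ k)) ≈⟨ ∘-resp-≈ʳ assoc ⟨
      f ∘ ((g ∘ h) ∘ k) ≈⟨ ∘-resp-≈ʳ (∘-resp-≈ˡ p) ⟩
      f ∘ (id ∘ k)      ≈⟨ ∘-resp-≈ʳ identityˡ ⟩
      f ∘ k             ∎
      where open HomReasoning

  ≅-trans : ∀ {A B C} → A ≅ B → B ≅ C → A ≅ C
  ≅-trans i j = record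
    { from = J.from ∘ I.from
    ; to   = I.to ∘ J.to
    ; isoˡ = Equiv.trans (cancel-inner J.isoˡ) I.isoˡ
    ; isoʳ = Equiv.trans (cancel-inner I.isoʳ) J.isoʳ
    }
    where module I = _≅_ i
          module J = _≅_ j

record Functor (C : Category o ℓ e) (D : Category o′ ℓ′ e′) :
               Set (o ⊔ ℓ ⊔ e ⊔ o′ ⊔ ℓ′ ⊔ e′) where
  private
    module C = Category C
    module D = Category D
  field
    F₀ : C.Obj → D.Obj
    F₁ : ∀ {A B} → A C.⇒ B → F₀ A D.⇒ F₀ B

    identity     : ∀ {A} → F₁ (C.id {A}) D.≈ D.id
    homomorphism : ∀ {X Y Z} {f : X C.⇒ Y} {g : Y C.⇒ Z} →
                   F₁ (g C.∘ f) D.≈ F₁ g D.∘ F₁ f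
    F-resp-≈     : ∀ {A B} {f g : A C.⇒ B} → f C.≈ g → F₁ f D.≈ F₁ g

  mapIso : ∀ {A B} → A C.≅ B → F₀ A D.≅ F₀ B
  mapIso i = record
    { from = F₁ from
    ; to   = F₁ to
    ; isoˡ = D.Equiv.trans (D.Equiv.sym homomorphism) (D.Equiv.trans (F-resp-≈ isoˡ) identity)
    ; isoʳ = D.Equiv.trans (D.Equiv.sym homomorphism) (D.Equiv.trans (F-resp-≈ isoʳ) identity)
    }
    where open C._≅_ i

record MonoidalCategory (o ℓ e : Level) : Set (lsuc (o ⊔ ℓ ⊔ e)) where
  infixr 10 _⊗₀_ _⊗₁_
  field
    U : Category o ℓ e
  open Category U public
  field
    unit : Obj
    _⊗₀_ : Obj → Obj → Obj
    _⊗₁_ : ∀ {A B C D} → A ⇒ B → C ⇒ D → (A ⊗₀ C) ⇒ (B ⊗₀ D)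

    ⊗-identity     : ∀ {A B} → id {A} ⊗₁ id {B} ≈ id
    ⊗-homomorphism : ∀ {A B C A′ B′ C′} {f : A ⇒ B} {g : B ⇒ C} {f′ : A′ ⇒ B′} {g′ : B′ ⇒ C′} →
                     (g ∘ f) ⊗₁ (g′ ∘ f′) ≈ (g ⊗₁ g′) ∘ (f ⊗₁ f′)
    ⊗-resp-≈       : ∀ {A B C D} {f g : A ⇒ B} {h i : C ⇒ D} →
                     f ≈ g → h ≈ i → f ⊗₁ h ≈ g ⊗₁ i

    unitorˡ    : ∀ {X} → unit ⊗₀ X ≅ X
    unitorʳ    : ∀ {X} → X ⊗₀ unit ≅ X
    associator : ∀ {X Y Z} → (X ⊗₀ Y) ⊗₀ Z ≅ X ⊗₀ (Y ⊗₀ Z)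

  module unitorˡ {X}        = _≅_ (unitorˡ {X})
  module unitorʳ {X}        = _≅_ (unitorʳ {X})
  module associator {X Y Z} = _≅_ (associator {X} {Y} {Z})

  λ⇒ : ∀ {X} → unit ⊗₀ X ⇒ X
  λ⇒ = unitorˡ.from

  ρ⇒ : ∀ {X} → X ⊗₀ unit ⇒ X
  ρ⇒ = unitorʳ.from

  α⇒ : ∀ {X Y Z} → (X ⊗₀ Y) ⊗₀ Z ⇒ X ⊗₀ (Y ⊗₀ Z)
  α⇒ = associator.from

  field
    unitorˡ-natural    : ∀ {X Y} {f : X ⇒ Y} → λ⇒ ∘ (id ⊗₁ f) ≈ f ∘ λ⇒
    unitorʳ-natural    : ∀ {X Y} {f : X ⇒ Y} → ρ⇒ ∘ (f ⊗₁ id) ≈ f ∘ ρ⇒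
    associator-natural : ∀ {X Y Z X′ Y′ Z′} {f : X ⇒ X′} {g : Y ⇒ Y′} {h : Z ⇒ Z′} →
                         α⇒ ∘ ((f ⊗₁ g) ⊗₁ h) ≈ (f ⊗₁ (g ⊗₁ h)) ∘ α⇒
    triangle           : ∀ {X Y} → (id {X} ⊗₁ λ⇒ {Y}) ∘ α⇒ ≈ ρ⇒ ⊗₁ id
    pentagon           : ∀ {X Y Z W} →
                         (id {X} ⊗₁ α⇒ {Y} {Z} {W}) ∘ (α⇒ ∘ (α⇒ ⊗₁ id)) ≈ α⇒ ∘ α⇒

  infixr 10 _⊗ᵢ_
  _⊗ᵢ_ : ∀ {A B C D} → A ≅ B → C ≅ D → A ⊗₀ C ≅ B ⊗₀ D
  i ⊗ᵢ j = record
    { from = I.from ⊗₁ J.from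
    ; to   = I.to ⊗₁ J.to
    ; isoˡ = Equiv.trans (Equiv.sym ⊗-homomorphism) (Equiv.trans (⊗-resp-≈ I.isoˡ J.isoˡ) ⊗-identity)
    ; isoʳ = Equiv.trans (Equiv.sym ⊗-homomorphism) (Equiv.trans (⊗-resp-≈ I.isoʳ J.isoʳ) ⊗-identity)
    }
    where module I = _≅_ i
          module J = _≅_ j

record SymmetricMonoidalCategory (o ℓ e : Level) : Set (lsuc (o ⊔ ℓ ⊔ e)) where
  field
    monoidal : MonoidalCategory o ℓ e
  open MonoidalCategory monoidal public
  field
    braid         : ∀ {X Y} → X ⊗₀ Y ⇒ Y ⊗₀ X
    braid-natural : ∀ {X Y X′ Y′} {f : X ⇒ X′} {g : Y ⇒ Y′} →
                    braid ∘ (f ⊗₁ g) ≈ (g ⊗₁ f) ∘ braid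
    braid-inverse : ∀ {X Y} → braid {Y} {X} ∘ braid {X} {Y} ≈ id
    hexagon       : ∀ {X Y Z} →
                    (id ⊗₁ braid) ∘ (α⇒ ∘ (braid ⊗₁ id)) ≈ α⇒ {Y} {Z} {X} ∘ (braid ∘ α⇒)

-- Monoidal functors are strong.

record MonoidalFunctor (C : MonoidalCategory o ℓ e) (D : MonoidalCategory o′ ℓ′ e′) :
                       Set (o ⊔ ℓ ⊔ e ⊔ o′ ⊔ ℓ′ ⊔ e′) where
  private
    module C = MonoidalCategory C
    module D = MonoidalCategory D
  field
    F : Functor C.U D.U
  open Functor F public
  field
    ε : D.unit D.≅ F₀ C.unit
    μ : ∀ {X Y} → F₀ X D.⊗₀ F₀ Y D.≅ F₀ (X C.⊗₀ Y)

  module ε         = D._≅_ ε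
  module μ {X} {Y} = D._≅_ (μ {X} {Y})

  field
    μ-natural     : ∀ {X Y X′ Y′} {f : X C.⇒ X′} {g : Y C.⇒ Y′} →
                    μ.from D.∘ (F₁ f D.⊗₁ F₁ g) D.≈ F₁ (f C.⊗₁ g) D.∘ μ.from
    associativity : ∀ {X Y Z} →
                    F₁ (C.α⇒ {X} {Y} {Z}) D.∘ (μ.from D.∘ (μ.from D.⊗₁ D.id))
                    D.≈ μ.from D.∘ ((D.id D.⊗₁ μ.from) D.∘ D.α⇒)
    unitaryˡ      : ∀ {X} → F₁ (C.λ⇒ {X}) D.∘ (μ.from D.∘ (ε.from D.⊗₁ D.id)) D.≈ D.λ⇒
    unitaryʳ      : ∀ {X} → F₁ (C.ρ⇒ {X}) D.∘ (μ.from D.∘ (D.id D.⊗₁ ε.from)) D.≈ D.ρ⇒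

record SymmetricMonoidalFunctor
         (C : SymmetricMonoidalCategory o ℓ e) (D : SymmetricMonoidalCategory o′ ℓ′ e′) :
         Set (o ⊔ ℓ ⊔ e ⊔ o′ ⊔ ℓ′ ⊔ e′) where
  private
    module C = SymmetricMonoidalCategory C
    module D = SymmetricMonoidalCategory D
  field
    monoidalFunctor : MonoidalFunctor C.monoidal D.monoidal
  open MonoidalFunctor monoidalFunctor public
  field
    braid-compat : ∀ {X Y} → F₁ (C.braid {X} {Y}) D.∘ μ.from D.≈ μ.from D.∘ D.braid

record MonoidalNaturalTransformation
         {C : SymmetricMonoidalCategory o ℓ e} {D : SymmetricMonoidalCategory o′ ℓ′ e′}
         (F G : SymmetricMonoidalFunctor C D) :
         Set (o ⊔ ℓ ⊔ e ⊔ o′ ⊔ ℓ′ ⊔ e′) where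
  private
    module C = SymmetricMonoidalCategory C
    module D = SymmetricMonoidalCategory D
    module F = SymmetricMonoidalFunctor F
    module G = SymmetricMonoidalFunctor G
  field
    η        : ∀ X → F.F₀ X D.⇒ G.F₀ X
    commute  : ∀ {X Y} (f : X C.⇒ Y) → η Y D.∘ F.F₁ f D.≈ G.F₁ f D.∘ η X
    η-unit   : η C.unit D.∘ F.ε.from D.≈ G.ε.from
    η-tensor : ∀ {X Y} → η (X C.⊗₀ Y) D.∘ F.μ.from D.≈ G.μ.from D.∘ (η X D.⊗₁ η Y)

-- Symmetric monoidal endofunctors of C and monoidal natural
-- transformations, monoidal under composition

module _ (C : SymmetricMonoidalCategory o ℓ e) where
  open SymmetricMonoidalCategory C
  open HomReasoning
  private
    Endo = SymmetricMonoidalFunctor C C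
    module Endo = SymmetricMonoidalFunctor
    _⟹_ = MonoidalNaturalTransformation {C = C} {D = C}
    module ⟹ = MonoidalNaturalTransformation

    pullˡ : ∀ {A B B′ C D} {f : A ⇒ B} {g : B ⇒ C} {h : C ⇒ D} {k : B′ ⇒ D} {l : B ⇒ B′} →
            h ∘ g ≈ k ∘ l → h ∘ (g ∘ f) ≈ k ∘ (l ∘ f)
    pullˡ p = Equiv.trans (Equiv.sym assoc) (Equiv.trans (∘-resp-≈ˡ p) assoc)

    merge : ∀ {A B C D} {f : A ⇒ B} {g : B ⇒ C} {h : C ⇒ D} {k : B ⇒ D} →
            h ∘ g ≈ k → h ∘ (g ∘ f) ≈ k ∘ f
    merge p = Equiv.trans (Equiv.sym assoc) (∘-resp-≈ˡ p)

    sandwich : ∀ {A B C B′ D} {f : A ⇒ B} {g : B ⇒ C} {h : C ⇒ D} {f′ : A ⇒ B′} {g′ : B′ ⇒ C} →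
               g ∘ f ≈ g′ ∘ f′ → (h ∘ g) ∘ f ≈ (h ∘ g′) ∘ f′
    sandwich p = Equiv.trans assoc (Equiv.trans (∘-resp-≈ʳ p) (Equiv.sym assoc))

    split-⊗ˡ : ∀ {A B C D} {f : A ⇒ B} {g : B ⇒ C} → (g ∘ f) ⊗₁ id {D} ≈ (g ⊗₁ id) ∘ (f ⊗₁ id)
    split-⊗ˡ = Equiv.trans (⊗-resp-≈ Equiv.refl (Equiv.sym identityˡ)) ⊗-homomorphism

    split-⊗ʳ : ∀ {A B C D} {f : A ⇒ B} {g : B ⇒ C} → id {D} ⊗₁ (g ∘ f) ≈ (id ⊗₁ g) ∘ (id ⊗₁ f)
    split-⊗ʳ = Equiv.trans (⊗-resp-≈ (Equiv.sym identityˡ) Equiv.refl) ⊗-homomorphism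

    id-comm : ∀ {A B} {f : A ⇒ B} → id ∘ f ≈ f ∘ id
    id-comm = Equiv.trans identityˡ (Equiv.sym identityʳ)

  idEndo : Endo
  idEndo = record
    { monoidalFunctor = record
      { F = record
        { F₀           = λ X → X
        ; F₁           = λ f → f
        ; identity     = Equiv.refl
        ; homomorphism = Equiv.refl
        ; F-resp-≈     = λ p → p
        }
      ; ε = ≅-refl
      ; μ = ≅-refl
      ; μ-natural     = id-comm
      ; associativity = begin
          α⇒ ∘ (id ∘ (id ⊗₁ id)) ≈⟨ ∘-resp-≈ʳ (Equiv.trans identityˡ ⊗-identity) ⟩
          α⇒ ∘ id                ≈⟨ id-comm ⟨
          id ∘ α⇒                ≈⟨ ∘-resp-≈ʳ (Equiv.trans (∘-resp-≈ˡ ⊗-identity) identityˡ) ⟨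
          id ∘ ((id ⊗₁ id) ∘ α⇒) ∎
      ; unitaryˡ = Equiv.trans (∘-resp-≈ʳ (Equiv.trans identityˡ ⊗-identity)) identityʳ
      ; unitaryʳ = Equiv.trans (∘-resp-≈ʳ (Equiv.trans identityˡ ⊗-identity)) identityʳ
      }
    ; braid-compat = Equiv.sym id-comm
    }

  infixr 9 _∘ᴱ_
  _∘ᴱ_ : Endo → Endo → Endo
  F ∘ᴱ G = record
    { monoidalFunctor = record
      { F = record
        { F₀           = λ X → F.F₀ (G.F₀ X)
        ; F₁           = λ f → F.F₁ (G.F₁ f)
        ; identity     = Equiv.trans (F.F-resp-≈ G.identity) F.identity
        ; homomorphism = Equiv.trans (F.F-resp-≈ G.homomorphism) F.homomorphism
        ; F-resp-≈     = λ p → F.F-resp-≈ (G.F-resp-≈ p)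
        }
      ; ε = ≅-trans F.ε (F.mapIso G.ε)
      ; μ = ≅-trans F.μ (F.mapIso G.μ)
      ; μ-natural = λ {_} {_} {_} {_} {f} {g} → begin
          (F.F₁ G.μ.from ∘ F.μ.from) ∘ (F.F₁ (G.F₁ f) ⊗₁ F.F₁ (G.F₁ g))
            ≈⟨ sandwich F.μ-natural ⟩
          (F.F₁ G.μ.from ∘ F.F₁ (G.F₁ f ⊗₁ G.F₁ g)) ∘ F.μ.from
            ≈⟨ ∘-resp-≈ˡ F.homomorphism ⟨
          F.F₁ (G.μ.from ∘ (G.F₁ f ⊗₁ G.F₁ g)) ∘ F.μ.from
            ≈⟨ ∘-resp-≈ˡ (F.F-resp-≈ G.μ-natural) ⟩
          F.F₁ (G.F₁ (f ⊗₁ g) ∘ G.μ.from) ∘ F.μ.from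
            ≈⟨ ∘-resp-≈ˡ F.homomorphism ⟩
          (F.F₁ (G.F₁ (f ⊗₁ g)) ∘ F.F₁ G.μ.from) ∘ F.μ.from
            ≈⟨ assoc ⟩
          F.F₁ (G.F₁ (f ⊗₁ g)) ∘ (F.F₁ G.μ.from ∘ F.μ.from) ∎
      ; associativity = begin
          F.F₁ (G.F₁ α⇒) ∘ ((F.F₁ G.μ.from ∘ F.μ.from) ∘ ((F.F₁ G.μ.from ∘ F.μ.from) ⊗₁ id))
            ≈⟨ ∘-resp-≈ʳ (expandˡ (G.μ.from)) ⟩
          F.F₁ (G.F₁ α⇒) ∘ (F.F₁ (G.μ.from ∘ (G.μ.from ⊗₁ id)) ∘ (F.μ.from ∘ (F.μ.from ⊗₁ id)))
            ≈⟨ merge (Equiv.sym F.homomorphism) ⟩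
          F.F₁ (G.F₁ α⇒ ∘ (G.μ.from ∘ (G.μ.from ⊗₁ id))) ∘ (F.μ.from ∘ (F.μ.from ⊗₁ id))
            ≈⟨ ∘-resp-≈ˡ (F.F-resp-≈ (Equiv.trans G.associativity (Equiv.sym assoc))) ⟩
          F.F₁ ((G.μ.from ∘ (id ⊗₁ G.μ.from)) ∘ α⇒) ∘ (F.μ.from ∘ (F.μ.from ⊗₁ id))
            ≈⟨ ∘-resp-≈ˡ F.homomorphism ⟩
          (F.F₁ (G.μ.from ∘ (id ⊗₁ G.μ.from)) ∘ F.F₁ α⇒) ∘ (F.μ.from ∘ (F.μ.from ⊗₁ id))
            ≈⟨ sandwich F.associativity ⟩
          (F.F₁ (G.μ.from ∘ (id ⊗₁ G.μ.from)) ∘ F.μ.from) ∘ ((id ⊗₁ F.μ.from) ∘ α⇒)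
            ≈⟨ assoc ⟩
          F.F₁ (G.μ.from ∘ (id ⊗₁ G.μ.from)) ∘ (F.μ.from ∘ ((id ⊗₁ F.μ.from) ∘ α⇒))
            ≈⟨ ∘-resp-≈ʳ assoc ⟨
          F.F₁ (G.μ.from ∘ (id ⊗₁ G.μ.from)) ∘ ((F.μ.from ∘ (id ⊗₁ F.μ.from)) ∘ α⇒)
            ≈⟨ assoc ⟨
          (F.F₁ (G.μ.from ∘ (id ⊗₁ G.μ.from)) ∘ (F.μ.from ∘ (id ⊗₁ F.μ.from))) ∘ α⇒
            ≈⟨ ∘-resp-≈ˡ (expandʳ G.μ.from) ⟨
          ((F.F₁ G.μ.from ∘ F.μ.from) ∘ (id ⊗₁ (F.F₁ G.μ.from ∘ F.μ.from))) ∘ α⇒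
            ≈⟨ assoc ⟩
          (F.F₁ G.μ.from ∘ F.μ.from) ∘ ((id ⊗₁ (F.F₁ G.μ.from ∘ F.μ.from)) ∘ α⇒) ∎
      ; unitaryˡ = begin
          F.F₁ (G.F₁ λ⇒) ∘ ((F.F₁ G.μ.from ∘ F.μ.from) ∘ ((F.F₁ G.ε.from ∘ F.ε.from) ⊗₁ id))
            ≈⟨ ∘-resp-≈ʳ (expandˡ G.ε.from) ⟩
          F.F₁ (G.F₁ λ⇒) ∘ (F.F₁ (G.μ.from ∘ (G.ε.from ⊗₁ id)) ∘ (F.μ.from ∘ (F.ε.from ⊗₁ id)))
            ≈⟨ merge (Equiv.sym F.homomorphism) ⟩
          F.F₁ (G.F₁ λ⇒ ∘ (G.μ.from ∘ (G.ε.from ⊗₁ id))) ∘ (F.μ.from ∘ (F.ε.from ⊗₁ id))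
            ≈⟨ ∘-resp-≈ˡ (F.F-resp-≈ G.unitaryˡ) ⟩
          F.F₁ λ⇒ ∘ (F.μ.from ∘ (F.ε.from ⊗₁ id))
            ≈⟨ F.unitaryˡ ⟩
          λ⇒ ∎
      ; unitaryʳ = begin
          F.F₁ (G.F₁ ρ⇒) ∘ ((F.F₁ G.μ.from ∘ F.μ.from) ∘ (id ⊗₁ (F.F₁ G.ε.from ∘ F.ε.from)))
            ≈⟨ ∘-resp-≈ʳ (expandʳ G.ε.from) ⟩
          F.F₁ (G.F₁ ρ⇒) ∘ (F.F₁ (G.μ.from ∘ (id ⊗₁ G.ε.from)) ∘ (F.μ.from ∘ (id ⊗₁ F.ε.from)))
            ≈⟨ merge (Equiv.sym F.homomorphism) ⟩
          F.F₁ (G.F₁ ρ⇒ ∘ (G.μ.from ∘ (id ⊗₁ G.ε.from))) ∘ (F.μ.from ∘ (id ⊗₁ F.ε.from))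
            ≈⟨ ∘-resp-≈ˡ (F.F-resp-≈ G.unitaryʳ) ⟩
          F.F₁ ρ⇒ ∘ (F.μ.from ∘ (id ⊗₁ F.ε.from))
            ≈⟨ F.unitaryʳ ⟩
          ρ⇒ ∎
      }
    ; braid-compat = begin
        F.F₁ (G.F₁ braid) ∘ (F.F₁ G.μ.from ∘ F.μ.from)
          ≈⟨ merge (Equiv.sym F.homomorphism) ⟩
        F.F₁ (G.F₁ braid ∘ G.μ.from) ∘ F.μ.from
          ≈⟨ ∘-resp-≈ˡ (Equiv.trans (F.F-resp-≈ G.braid-compat) F.homomorphism) ⟩
        (F.F₁ G.μ.from ∘ F.F₁ braid) ∘ F.μ.from
          ≈⟨ sandwich F.braid-compat ⟩
        (F.F₁ G.μ.from ∘ F.μ.from) ∘ braid ∎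
    }
    where
    module F = Endo F
    module G = Endo G

    expandˡ : ∀ {A X Y Z} {m : G.F₀ X ⊗₀ G.F₀ Y ⇒ Z} (g : A ⇒ G.F₀ X)
              {B} {f : B ⇒ F.F₀ A} →
              (F.F₁ m ∘ F.μ.from) ∘ ((F.F₁ g ∘ f) ⊗₁ id) ≈
              F.F₁ (m ∘ (g ⊗₁ id)) ∘ (F.μ.from ∘ (f ⊗₁ id))
    expandˡ {m = m} g {f = f} = begin
      (F.F₁ m ∘ F.μ.from) ∘ ((F.F₁ g ∘ f) ⊗₁ id)
        ≈⟨ ∘-resp-≈ʳ split-⊗ˡ ⟩
      (F.F₁ m ∘ F.μ.from) ∘ ((F.F₁ g ⊗₁ id) ∘ (f ⊗₁ id))
        ≈⟨ assoc ⟨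
      ((F.F₁ m ∘ F.μ.from) ∘ (F.F₁ g ⊗₁ id)) ∘ (f ⊗₁ id)
        ≈⟨ ∘-resp-≈ˡ (∘-resp-≈ʳ (⊗-resp-≈ Equiv.refl F.identity)) ⟨
      ((F.F₁ m ∘ F.μ.from) ∘ (F.F₁ g ⊗₁ F.F₁ id)) ∘ (f ⊗₁ id)
        ≈⟨ ∘-resp-≈ˡ (sandwich F.μ-natural) ⟩
      ((F.F₁ m ∘ F.F₁ (g ⊗₁ id)) ∘ F.μ.from) ∘ (f ⊗₁ id)
        ≈⟨ assoc ⟩
      (F.F₁ m ∘ F.F₁ (g ⊗₁ id)) ∘ (F.μ.from ∘ (f ⊗₁ id))
        ≈⟨ ∘-resp-≈ˡ F.homomorphism ⟨
      F.F₁ (m ∘ (g ⊗₁ id)) ∘ (F.μ.from ∘ (f ⊗₁ id)) ∎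

    expandʳ : ∀ {A X Y Z} {m : G.F₀ X ⊗₀ G.F₀ Y ⇒ Z} (g : A ⇒ G.F₀ Y)
              {B} {f : B ⇒ F.F₀ A} →
              (F.F₁ m ∘ F.μ.from) ∘ (id ⊗₁ (F.F₁ g ∘ f)) ≈
              F.F₁ (m ∘ (id ⊗₁ g)) ∘ (F.μ.from ∘ (id ⊗₁ f))
    expandʳ {m = m} g {f = f} = begin
      (F.F₁ m ∘ F.μ.from) ∘ (id ⊗₁ (F.F₁ g ∘ f))
        ≈⟨ ∘-resp-≈ʳ split-⊗ʳ ⟩
      (F.F₁ m ∘ F.μ.from) ∘ ((id ⊗₁ F.F₁ g) ∘ (id ⊗₁ f))
        ≈⟨ assoc ⟨
      ((F.F₁ m ∘ F.μ.from) ∘ (id ⊗₁ F.F₁ g)) ∘ (id ⊗₁ f)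
        ≈⟨ ∘-resp-≈ˡ (∘-resp-≈ʳ (⊗-resp-≈ F.identity Equiv.refl)) ⟨
      ((F.F₁ m ∘ F.μ.from) ∘ (F.F₁ id ⊗₁ F.F₁ g)) ∘ (id ⊗₁ f)
        ≈⟨ ∘-resp-≈ˡ (sandwich F.μ-natural) ⟩
      ((F.F₁ m ∘ F.F₁ (id ⊗₁ g)) ∘ F.μ.from) ∘ (id ⊗₁ f)
        ≈⟨ assoc ⟩
      (F.F₁ m ∘ F.F₁ (id ⊗₁ g)) ∘ (F.μ.from ∘ (id ⊗₁ f))
        ≈⟨ ∘-resp-≈ˡ F.homomorphism ⟨
      F.F₁ (m ∘ (id ⊗₁ g)) ∘ (F.μ.from ∘ (id ⊗₁ f)) ∎

  endofunctors : Category (o ⊔ ℓ ⊔ e) (o ⊔ ℓ ⊔ e) (o ⊔ e)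
  endofunctors = record
    { Obj = Endo
    ; _⇒_ = _⟹_
    ; _≈_ = λ α β → ∀ X → ⟹.η α X ≈ ⟹.η β X
    ; id  = record
      { η        = λ _ → id
      ; commute  = λ _ → id-comm
      ; η-unit   = identityˡ
      ; η-tensor = Equiv.trans id-comm (∘-resp-≈ʳ (Equiv.sym ⊗-identity))
      }
    ; _∘_ = λ β α → record
      { η        = λ X → ⟹.η β X ∘ ⟹.η α X
      ; commute  = λ f → Equiv.trans (sandwich (⟹.commute α f))
                           (Equiv.trans (∘-resp-≈ˡ (⟹.commute β f)) assoc)
      ; η-unit   = Equiv.trans assoc (Equiv.trans (∘-resp-≈ʳ (⟹.η-unit α)) (⟹.η-unit β))
      ; η-tensor = Equiv.trans (sandwich (⟹.η-tensor α))
                     (Equiv.trans (∘-resp-≈ˡ (⟹.η-tensor β))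
                       (Equiv.trans assoc (∘-resp-≈ʳ (Equiv.sym ⊗-homomorphism))))
      }
    ; assoc     = λ _ → assoc
    ; identityˡ = λ _ → identityˡ
    ; identityʳ = λ _ → identityʳ
    ; equiv     = record
      { refl  = λ _ → Equiv.refl
      ; sym   = λ p X → Equiv.sym (p X)
      ; trans = λ p q X → Equiv.trans (p X) (q X)
      }
    ; ∘-resp-≈  = λ p q X → ∘-resp-≈ (p X) (q X)
    }

  private
    _∘ₕ_ : ∀ {F F′ G G′} → F ⟹ F′ → G ⟹ G′ → (F ∘ᴱ G) ⟹ (F′ ∘ᴱ G′)
    _∘ₕ_ {F} {F′} {G} {G′} α β = record
      { η       = λ X → F′.F₁ (⟹.η β X) ∘ ⟹.η α (G.F₀ X)
      ; commute = λ {X} {Y} f → begin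
          (F′.F₁ (⟹.η β Y) ∘ ⟹.η α (G.F₀ Y)) ∘ F.F₁ (G.F₁ f)
            ≈⟨ sandwich (⟹.commute α (G.F₁ f)) ⟩
          (F′.F₁ (⟹.η β Y) ∘ F′.F₁ (G.F₁ f)) ∘ ⟹.η α (G.F₀ X)
            ≈⟨ ∘-resp-≈ˡ F′.homomorphism ⟨
          F′.F₁ (⟹.η β Y ∘ G.F₁ f) ∘ ⟹.η α (G.F₀ X)
            ≈⟨ ∘-resp-≈ˡ (Equiv.trans (F′.F-resp-≈ (⟹.commute β f)) F′.homomorphism) ⟩
          (F′.F₁ (G′.F₁ f) ∘ F′.F₁ (⟹.η β X)) ∘ ⟹.η α (G.F₀ X)
            ≈⟨ assoc ⟩
          F′.F₁ (G′.F₁ f) ∘ (F′.F₁ (⟹.η β X) ∘ ⟹.η α (G.F₀ X)) ∎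
      ; η-unit = begin
          (F′.F₁ (⟹.η β unit) ∘ ⟹.η α (G.F₀ unit)) ∘ (F.F₁ G.ε.from ∘ F.ε.from)
            ≈⟨ assoc ⟩
          F′.F₁ (⟹.η β unit) ∘ (⟹.η α (G.F₀ unit) ∘ (F.F₁ G.ε.from ∘ F.ε.from))
            ≈⟨ ∘-resp-≈ʳ (pullˡ (⟹.commute α G.ε.from)) ⟩
          F′.F₁ (⟹.η β unit) ∘ (F′.F₁ G.ε.from ∘ (⟹.η α unit ∘ F.ε.from))
            ≈⟨ ∘-resp-≈ʳ (∘-resp-≈ʳ (⟹.η-unit α)) ⟩
          F′.F₁ (⟹.η β unit) ∘ (F′.F₁ G.ε.from ∘ F′.ε.from)
            ≈⟨ merge (Equiv.sym F′.homomorphism) ⟩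
          F′.F₁ (⟹.η β unit ∘ G.ε.from) ∘ F′.ε.from
            ≈⟨ ∘-resp-≈ˡ (F′.F-resp-≈ (⟹.η-unit β)) ⟩
          F′.F₁ G′.ε.from ∘ F′.ε.from ∎
      ; η-tensor = λ {X} {Y} → begin
          (F′.F₁ (⟹.η β (X ⊗₀ Y)) ∘ ⟹.η α (G.F₀ (X ⊗₀ Y))) ∘ (F.F₁ G.μ.from ∘ F.μ.from)
            ≈⟨ assoc ⟩
          F′.F₁ (⟹.η β (X ⊗₀ Y)) ∘ (⟹.η α (G.F₀ (X ⊗₀ Y)) ∘ (F.F₁ G.μ.from ∘ F.μ.from))
            ≈⟨ ∘-resp-≈ʳ (pullˡ (⟹.commute α G.μ.from)) ⟩
          F′.F₁ (⟹.η β (X ⊗₀ Y)) ∘ (F′.F₁ G.μ.from ∘ (⟹.η α (G.F₀ X ⊗₀ G.F₀ Y) ∘ F.μ.from))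
            ≈⟨ ∘-resp-≈ʳ (∘-resp-≈ʳ (⟹.η-tensor α)) ⟩
          F′.F₁ (⟹.η β (X ⊗₀ Y)) ∘ (F′.F₁ G.μ.from ∘ (F′.μ.from ∘ (⟹.η α (G.F₀ X) ⊗₁ ⟹.η α (G.F₀ Y))))
            ≈⟨ merge (Equiv.sym F′.homomorphism) ⟩
          F′.F₁ (⟹.η β (X ⊗₀ Y) ∘ G.μ.from) ∘ (F′.μ.from ∘ (⟹.η α (G.F₀ X) ⊗₁ ⟹.η α (G.F₀ Y)))
            ≈⟨ ∘-resp-≈ˡ (Equiv.trans (F′.F-resp-≈ (⟹.η-tensor β)) F′.homomorphism) ⟩
          (F′.F₁ G′.μ.from ∘ F′.F₁ (⟹.η β X ⊗₁ ⟹.η β Y)) ∘ (F′.μ.from ∘ (⟹.η α (G.F₀ X) ⊗₁ ⟹.η α (G.F₀ Y)))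
            ≈⟨ assoc ⟩
          F′.F₁ G′.μ.from ∘ (F′.F₁ (⟹.η β X ⊗₁ ⟹.η β Y) ∘ (F′.μ.from ∘ (⟹.η α (G.F₀ X) ⊗₁ ⟹.η α (G.F₀ Y))))
            ≈⟨ ∘-resp-≈ʳ (pullˡ (Equiv.sym F′.μ-natural)) ⟩
          F′.F₁ G′.μ.from ∘ (F′.μ.from ∘ ((F′.F₁ (⟹.η β X) ⊗₁ F′.F₁ (⟹.η β Y)) ∘ (⟹.η α (G.F₀ X) ⊗₁ ⟹.η α (G.F₀ Y))))
            ≈⟨ ∘-resp-≈ʳ (∘-resp-≈ʳ ⊗-homomorphism) ⟨
          F′.F₁ G′.μ.from ∘ (F′.μ.from ∘ ((F′.F₁ (⟹.η β X) ∘ ⟹.η α (G.F₀ X)) ⊗₁ (F′.F₁ (⟹.η β Y) ∘ ⟹.η α (G.F₀ Y))))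
            ≈⟨ assoc ⟨
          (F′.F₁ G′.μ.from ∘ F′.μ.from) ∘ ((F′.F₁ (⟹.η β X) ∘ ⟹.η α (G.F₀ X)) ⊗₁ (F′.F₁ (⟹.η β Y) ∘ ⟹.η α (G.F₀ Y))) ∎
      }
      where
      module F  = Endo F
      module F′ = Endo F′
      module G  = Endo G
      module G′ = Endo G′

    id-unit : ∀ {A B} {f g : A ⇒ B} → f ≈ g → id ∘ f ≈ g
    id-unit p = Equiv.trans identityˡ p

    id-tensor : ∀ {X Y Z} {f g : X ⊗₀ Y ⇒ Z} → f ≈ g → id ∘ f ≈ g ∘ (id ⊗₁ id)
    id-tensor p = Equiv.trans id-comm (∘-resp-≈ p (Equiv.sym ⊗-identity))

    module _ (F : Endo) where
      private module F = Endo F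

      F-id-∘ : ∀ {A X} {f : A ⇒ F.F₀ X} → F.F₁ id ∘ f ≈ f
      F-id-∘ = Equiv.trans (∘-resp-≈ˡ F.identity) identityˡ

      F-∘-∘ : ∀ {A X Y Z} {f : A ⇒ F.F₀ X} {g : X ⇒ Y} {h : Y ⇒ Z} →
              F.F₁ h ∘ (F.F₁ g ∘ f) ≈ F.F₁ (h ∘ g) ∘ f
      F-∘-∘ = merge (Equiv.sym F.homomorphism)

  -- The unitors and the associator have identity components.
  endofunctors-monoidal : MonoidalCategory (o ⊔ ℓ ⊔ e) (o ⊔ ℓ ⊔ e) (o ⊔ e)
  endofunctors-monoidal = record
    { U    = endofunctors
    ; unit = idEndo
    ; _⊗₀_ = _∘ᴱ_
    ; _⊗₁_ = _∘ₕ_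
    ; ⊗-identity     = λ {F} _ → F-id-∘ F
    ; ⊗-homomorphism = λ {_} {F₁} {F₂} {_} {_} {_} {f} {g} {f′} {g′} X →
        let module F₂ = Endo F₂ in begin
          F₂.F₁ (⟹.η g′ X ∘ ⟹.η f′ X) ∘ (⟹.η g _ ∘ ⟹.η f _)
            ≈⟨ ∘-resp-≈ˡ F₂.homomorphism ⟩
          (F₂.F₁ (⟹.η g′ X) ∘ F₂.F₁ (⟹.η f′ X)) ∘ (⟹.η g _ ∘ ⟹.η f _)
            ≈⟨ assoc ⟩
          F₂.F₁ (⟹.η g′ X) ∘ (F₂.F₁ (⟹.η f′ X) ∘ (⟹.η g _ ∘ ⟹.η f _))
            ≈⟨ ∘-resp-≈ʳ (pullˡ (Equiv.sym (⟹.commute g (⟹.η f′ X)))) ⟩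
          F₂.F₁ (⟹.η g′ X) ∘ (⟹.η g _ ∘ (Endo.F₁ F₁ (⟹.η f′ X) ∘ ⟹.η f _))
            ≈⟨ assoc ⟨
          (F₂.F₁ (⟹.η g′ X) ∘ ⟹.η g _) ∘ (Endo.F₁ F₁ (⟹.η f′ X) ∘ ⟹.η f _) ∎
    ; ⊗-resp-≈ = λ {_} {G} p q X → ∘-resp-≈ (Endo.F-resp-≈ G (q X)) (p _)
    ; unitorˡ = record
      { from = record
        { η        = λ _ → id
        ; commute  = λ _ → id-comm
        ; η-unit   = id-unit identityʳ
        ; η-tensor = id-tensor identityʳ
        }
      ; to = record
        { η        = λ _ → id
        ; commute  = λ _ → id-comm
        ; η-unit   = id-unit (Equiv.sym identityʳ)
        ; η-tensor = id-tensor (Equiv.sym identityʳ)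
        }
      ; isoˡ = λ _ → identityˡ
      ; isoʳ = λ _ → identityˡ
      }
    ; unitorʳ = λ {F} → record
      { from = record
        { η        = λ _ → id
        ; commute  = λ _ → id-comm
        ; η-unit   = id-unit (F-id-∘ F)
        ; η-tensor = id-tensor (F-id-∘ F)
        }
      ; to = record
        { η        = λ _ → id
        ; commute  = λ _ → id-comm
        ; η-unit   = id-unit (Equiv.sym (F-id-∘ F))
        ; η-tensor = id-tensor (Equiv.sym (F-id-∘ F))
        }
      ; isoˡ = λ _ → identityˡ
      ; isoʳ = λ _ → identityˡ
      }
    ; associator = λ {F} → record
      { from = record
        { η        = λ _ → id
        ; commute  = λ _ → id-comm
        ; η-unit   = id-unit (F-∘-∘ F)
        ; η-tensor = id-tensor (F-∘-∘ F)
        }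
      ; to = record
        { η        = λ _ → id
        ; commute  = λ _ → id-comm
        ; η-unit   = id-unit (Equiv.sym (F-∘-∘ F))
        ; η-tensor = id-tensor (Equiv.sym (F-∘-∘ F))
        }
      ; isoˡ = λ _ → identityˡ
      ; isoʳ = λ _ → identityˡ
      }
    ; unitorˡ-natural    = λ _ → identityˡ
    ; unitorʳ-natural    = λ {_} {G} _ → Equiv.trans (id-unit (F-id-∘ G)) (Equiv.sym identityʳ)
    ; associator-natural = λ {_} {_} {_} {F′} _ →
        Equiv.trans (id-unit (F-∘-∘ F′)) (Equiv.sym identityʳ)
    ; triangle = λ _ → identityʳ
    ; pentagon = λ {F} {G} {H} _ →
        Equiv.trans (∘-resp-≈ˡ (F-id-∘ F))
          (∘-resp-≈ʳ (Equiv.trans identityˡ (F-id-∘ (F ∘ᴱ (G ∘ᴱ H)))))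
    }

-- A monoid as a discrete monoidal category: a morphism x ⇒ y is a proof
-- of x ≈ y, and parallel morphisms are equal

module Discrete {c ℓ} (M : Monoid c ℓ) where
  private module M = Monoid M

  category : Category c ℓ 0ℓ
  category = record
    { Obj       = M.Carrier
    ; _⇒_       = M._≈_
    ; _≈_       = λ _ _ → ⊤
    ; id        = M.refl
    ; _∘_       = λ q p → M.trans p q
    ; assoc     = tt
    ; identityˡ = tt
    ; identityʳ = tt
    ; equiv     = record { refl = tt ; sym = λ _ → tt ; trans = λ _ _ → tt }
    ; ∘-resp-≈  = λ _ _ → tt
    }

  ≈⇒≅ : ∀ {x y} → x M.≈ y → Category._≅_ category x y
  ≈⇒≅ p = record { from = p ; to = M.sym p ; isoˡ = tt ; isoʳ = tt }

  monoidal : MonoidalCategory c ℓ 0ℓ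
  monoidal = record
    { U                  = category
    ; unit               = M.ε
    ; _⊗₀_               = M._∙_
    ; _⊗₁_               = M.∙-cong
    ; ⊗-identity         = tt
    ; ⊗-homomorphism     = tt
    ; ⊗-resp-≈           = λ _ _ → tt
    ; unitorˡ            = ≈⇒≅ (M.identityˡ _)
    ; unitorʳ            = ≈⇒≅ (M.identityʳ _)
    ; associator         = ≈⇒≅ (M.assoc _ _ _)
    ; unitorˡ-natural    = tt
    ; unitorʳ-natural    = tt
    ; associator-natural = tt
    ; triangle           = tt
    ; pentagon           = tt
    }

record Signature (q g : Level) : Set (lsuc (q ⊔ g)) where
  field
    Qubit           : Set q
    Gate            : Set g
    qubits          : Gate → List Qubit
    qubits-distinct : ∀ G → Unique (qubits G)
    duration        : Gate → ℝ
    duration-nonneg : ∀ G → 0ᴿ ≤ᴿ duration G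

module Language {q g} (S : Signature q g) where
  open Signature S

  infixr 7 _⊗_
  data Type : Set q where
    𝟙     : Type
    qubit : Qubit → Type
    _⊗_   : Type → Type → Type
    □     : ℝ → Type → Type

  Var : Set
  Var = ℕ

  infix 5 _:^[_]_
  record Declaration : Set q where
    constructor _:^[_]_
    field
      name  : Var
      grade : ℝ
      type  : Type

  Context : Set q
  Context = List Declaration

  infixr 6 _+ᶜ_
  _+ᶜ_ : ℝ → Context → Context
  d +ᶜ Γ = map (λ (x :^[ d′ ] A) → x :^[ d +ᴿ d′ ] A) Γ

  data Term : Set where
    ∗     : Term
    var   : Var → Term
    ⟨_,_⟩ : Term → Term → Term
    box   : ℝ → Term → Term

  -- Equality of types, contexts and terms up to equality of the real
  -- numbers occurring in them.

  infix 4 _≈ᵗʸ_ _≈ᵈ_ _≈ᶜ_ _≈ᵗᵐ_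

  data _≈ᵗʸ_ : Type → Type → Set q where
    𝟙     : 𝟙 ≈ᵗʸ 𝟙
    qubit : ∀ k → qubit k ≈ᵗʸ qubit k
    _⊗_   : ∀ {A A′ B B′} → A ≈ᵗʸ A′ → B ≈ᵗʸ B′ → A ⊗ B ≈ᵗʸ A′ ⊗ B′
    □     : ∀ {d d′ A A′} → d ≈ᴿ d′ → A ≈ᵗʸ A′ → □ d A ≈ᵗʸ □ d′ A′

  data _≈ᵈ_ : Declaration → Declaration → Set q where
    decl : ∀ {x d d′ A A′} → d ≈ᴿ d′ → A ≈ᵗʸ A′ → (x :^[ d ] A) ≈ᵈ (x :^[ d′ ] A′)

  _≈ᶜ_ : Context → Context → Set q
  _≈ᶜ_ = Pointwise _≈ᵈ_

  data _≈ᵗᵐ_ : Term → Term → Set where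
    ∗     : ∗ ≈ᵗᵐ ∗
    var   : ∀ x → var x ≈ᵗᵐ var x
    ⟨_,_⟩ : ∀ {s s′ t t′} → s ≈ᵗᵐ s′ → t ≈ᵗᵐ t′ → ⟨ s , t ⟩ ≈ᵗᵐ ⟨ s′ , t′ ⟩
    box   : ∀ {d d′ t t′} → d ≈ᴿ d′ → t ≈ᵗᵐ t′ → box d t ≈ᵗᵐ box d′ t′

  -- Normal constructor terms.  The rule conv only identifies equal real
  -- numbers presented by different Cauchy sequences.

  infix 3 _⊢ₙ_∶_
  data _⊢ₙ_∶_ : Context → Term → Type → Set q where
    ∗    : [] ⊢ₙ ∗ ∶ 𝟙
    var  : ∀ x k → (x :^[ 0ᴿ ] qubit k) ∷ [] ⊢ₙ var x ∶ qubit k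
    pair : ∀ {Γ Δ s t A B} →
           Γ ⊢ₙ s ∶ A → Δ ⊢ₙ t ∶ B → Γ ++ Δ ⊢ₙ ⟨ s , t ⟩ ∶ A ⊗ B
    box  : ∀ {Γ t A} d → Γ ⊢ₙ t ∶ A → d +ᶜ Γ ⊢ₙ box d t ∶ □ d A
    conv : ∀ {Γ Γ′ t t′ A A′} → Γ ≈ᶜ Γ′ → t ≈ᵗᵐ t′ → A ≈ᵗʸ A′ →
           Γ ⊢ₙ t ∶ A → Γ′ ⊢ₙ t′ ∶ A′

module ℝ-discrete = Discrete (AbelianGroup.monoid ℝ-abelianGroup)

record Model {q g} (S : Signature q g) (o ℓ e : Level) : Set (q ⊔ g ⊔ lsuc (o ⊔ ℓ ⊔ e)) where
  open Signature S
  field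
    C : SymmetricMonoidalCategory o ℓ e
  open SymmetricMonoidalCategory C public
  field
    X     : Qubit → Obj
    Shift : MonoidalFunctor ℝ-discrete.monoidal (endofunctors-monoidal C)

  module Shift = MonoidalFunctor Shift
  module shift (d : ℝ) = SymmetricMonoidalFunctor (Shift.F₀ d)

  ⨂X : List Qubit → Obj
  ⨂X = foldr (λ k A → X k ⊗₀ A) unit

  shift-≈ : ∀ {d d′} → d ≈ᴿ d′ → ∀ A → shift.F₀ d A ⇒ shift.F₀ d′ A
  shift-≈ p = MonoidalNaturalTransformation.η (Shift.F₁ p)

  field
    gate       : ∀ G → shift.F₀ (-ᴿ duration G) (⨂X (qubits G)) ⇒ ⨂X (qubits G)
    delay      : ∀ x k → shift.F₀ (-ᴿ x) (X k) ⇒ X k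
    delay-cong : ∀ {x y} (p : x ≈ᴿ y) k → delay y k ∘ shift-≈ (-ᴿ-cong p) (X k) ≈ delay x k

module Interpretation {q g} {S : Signature q g} {o ℓ e} (M : Model S o ℓ e) where
  open Language S
  open Model M

  ⟦_⟧ : Type → Obj
  ⟦ 𝟙 ⟧       = unit
  ⟦ qubit k ⟧ = X k
  ⟦ A ⊗ B ⟧   = ⟦ A ⟧ ⊗₀ ⟦ B ⟧
  ⟦ □ d A ⟧   = shift.F₀ d ⟦ A ⟧

  ⟦_⟧ᶜ : Context → Obj
  ⟦ [] ⟧ᶜ                = unit
  ⟦ (x :^[ d ] A) ∷ Γ ⟧ᶜ = shift.F₀ d ⟦ A ⟧ ⊗₀ ⟦ Γ ⟧ᶜ

  private
    module End = MonoidalCategory (endofunctors-monoidal C)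

  component : ∀ {F G} → F End.≅ G → ∀ A →
              SymmetricMonoidalFunctor.F₀ F A ≅ SymmetricMonoidalFunctor.F₀ G A
  component i A = record
    { from = MonoidalNaturalTransformation.η I.from A
    ; to   = MonoidalNaturalTransformation.η I.to A
    ; isoˡ = I.isoˡ A
    ; isoʳ = I.isoʳ A
    }
    where module I = End._≅_ i

  -- The coherence isomorphisms of the model: those generated by the
  -- structure isomorphisms of C (without the braiding), of each
  -- Shift(d), and of Shift.  Equality of interpretations means
  -- equality up to these; already ⟦ x :^ 0 q ⟧ = Shift(0)(X_q) ⊗ I is
  -- only identified with X_q in this sense.

  data Coherent : ∀ {A B} → A ≅ B → Set (o ⊔ ℓ ⊔ e) where
    refl       : ∀ {A} → Coherent (≅-refl {A})
    sym        : ∀ {A B} {i : A ≅ B} → Coherent i → Coherent (≅-sym i)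
    trans      : ∀ {A B D} {i : A ≅ B} {j : B ≅ D} →
                 Coherent i → Coherent j → Coherent (≅-trans i j)

    tensor     : ∀ {A A′ B B′} {i : A ≅ A′} {j : B ≅ B′} →
                 Coherent i → Coherent j → Coherent (i ⊗ᵢ j)
    λ-iso      : ∀ {A} → Coherent (unitorˡ {A})
    ρ-iso      : ∀ {A} → Coherent (unitorʳ {A})
    α-iso      : ∀ {A B D} → Coherent (associator {A} {B} {D})

    -- Shift(d)(A) ≃ Shift(d)(B) for A ≃ B, I ≃ Shift(d)(I), and
    -- Shift(d)(A) ⊗ Shift(d)(B) ≃ Shift(d)(A ⊗ B)
    shift-map  : ∀ d {A B} {i : A ≅ B} → Coherent i → Coherent (shift.mapIso d i)
    shift-unit : ∀ d → Coherent (shift.ε d)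
    shift-⊗    : ∀ d {A B} → Coherent (shift.μ d {A} {B})

    -- Shift(d)(A) ≃ Shift(d′)(A) for d = d′, A ≃ Shift(0)(A), and
    -- Shift(d)(Shift(d′)(A)) ≃ Shift(d + d′)(A)
    shift-resp : ∀ {d d′} (p : d ≈ᴿ d′) A →
                 Coherent (component (Shift.mapIso (ℝ-discrete.≈⇒≅ p)) A)
    shift-0    : ∀ A → Coherent (component Shift.ε A)
    shift-+    : ∀ d d′ A → Coherent (component (Shift.μ {d} {d′}) A)

{-# OPTIONS --safe #-}
module Submission where

open import Defs
open import Data.List.Base using ([]; _∷_; _++_)
open import Data.List.Relation.Binary.Pointwise using ([]; _∷_)
open import Data.Product.Base using (Σ-syntax; _,_)
open import Level using (_⊔_)

module CoherentIsomorphism {q g} {S : Signature q g} {o ℓ e} (M : Model S o ℓ e) where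
  open Language S
  open Model M
  open Interpretation M

  infix  4 _≃_
  infixr 10 _⊗≃_

  _≃_ : Obj → Obj → Set (o ⊔ ℓ ⊔ e)
  A ≃ B = Σ[ i ∈ A ≅ B ] Coherent i

  ≃-refl : ∀ {A} → A ≃ A
  ≃-refl = _ , refl

  ≃-sym : ∀ {A B} → A ≃ B → B ≃ A
  ≃-sym (_ , c) = _ , sym c

  ≃-trans : ∀ {A B D} → A ≃ B → B ≃ D → A ≃ D
  ≃-trans (_ , c) (_ , c′) = _ , trans c c′

  _⊗≃_ : ∀ {A A′ B B′} → A ≃ A′ → B ≃ B′ → A ⊗₀ B ≃ A′ ⊗₀ B′
  (_ , c) ⊗≃ (_ , c′) = _ , tensor c c′

  shift-cong : ∀ {d d′ A B} → d ≈ᴿ d′ → A ≃ B → shift.F₀ d A ≃ shift.F₀ d′ B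
  shift-cong {d} p (_ , c) = ≃-trans (_ , shift-map d c) (_ , shift-resp p _)

  ⟦⟧-cong : ∀ {A B} → A ≈ᵗʸ B → ⟦ A ⟧ ≃ ⟦ B ⟧
  ⟦⟧-cong 𝟙         = ≃-refl
  ⟦⟧-cong (qubit k) = ≃-refl
  ⟦⟧-cong (p ⊗ r)   = ⟦⟧-cong p ⊗≃ ⟦⟧-cong r
  ⟦⟧-cong (□ p r)   = shift-cong p (⟦⟧-cong r)

  ⟦⟧ᶜ-cong : ∀ {Γ Δ} → Γ ≈ᶜ Δ → ⟦ Γ ⟧ᶜ ≃ ⟦ Δ ⟧ᶜ
  ⟦⟧ᶜ-cong []             = ≃-refl
  ⟦⟧ᶜ-cong (decl p r ∷ s) = shift-cong p (⟦⟧-cong r) ⊗≃ ⟦⟧ᶜ-cong s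

  ⟦++⟧ᶜ : ∀ Γ Δ → ⟦ Γ ++ Δ ⟧ᶜ ≃ ⟦ Γ ⟧ᶜ ⊗₀ ⟦ Δ ⟧ᶜ
  ⟦++⟧ᶜ []      Δ = ≃-sym (_ , λ-iso)
  ⟦++⟧ᶜ (_ ∷ Γ) Δ = ≃-trans (≃-refl ⊗≃ ⟦++⟧ᶜ Γ Δ) (≃-sym (_ , α-iso))

  ⟦+ᶜ⟧ᶜ : ∀ d Γ → ⟦ d +ᶜ Γ ⟧ᶜ ≃ shift.F₀ d ⟦ Γ ⟧ᶜ
  ⟦+ᶜ⟧ᶜ d []                  = _ , shift-unit d
  ⟦+ᶜ⟧ᶜ d ((_ :^[ d′ ] A) ∷ Γ) =
    ≃-trans (≃-sym (_ , shift-+ d d′ ⟦ A ⟧) ⊗≃ ⟦+ᶜ⟧ᶜ d Γ) (_ , shift-⊗ d)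

  ⊢ₙ⇒≃ : ∀ {Γ t A} → Γ ⊢ₙ t ∶ A → ⟦ Γ ⟧ᶜ ≃ ⟦ A ⟧
  ⊢ₙ⇒≃ ∗                       = ≃-refl
  ⊢ₙ⇒≃ (var x k)               = ≃-trans (_ , ρ-iso) (≃-sym (_ , shift-0 (X k)))
  ⊢ₙ⇒≃ (pair {Γ} {Δ} ⊢s ⊢t)    = ≃-trans (⟦++⟧ᶜ Γ Δ) (⊢ₙ⇒≃ ⊢s ⊗≃ ⊢ₙ⇒≃ ⊢t)
  ⊢ₙ⇒≃ (box {Γ} d ⊢t)          with _ , c ← ⊢ₙ⇒≃ ⊢t = ≃-trans (⟦+ᶜ⟧ᶜ d Γ) (_ , shift-map d c)
  ⊢ₙ⇒≃ (conv Γ≈Γ′ _ A≈A′ ⊢t)   =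
    ≃-trans (≃-sym (⟦⟧ᶜ-cong Γ≈Γ′)) (≃-trans (⊢ₙ⇒≃ ⊢t) (⟦⟧-cong A≈A′))

lemma19 : ∀ {q g o ℓ e} (S : Signature q g) (M : Model S o ℓ e) →
    let open Language S
        open Model M using (_≅_)
        open Interpretation M
    in ∀ {Γ : Context} {t : Term} {A : Type} →
       Γ ⊢ₙ t ∶ A → Σ[ i ∈ ⟦ Γ ⟧ᶜ ≅ ⟦ A ⟧ ] Coherent i
lemma19 S M = CoherentIsomorphism.⊢ₙ⇒≃ M
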